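{- Let $\mathfrak{C}=(G,X,H,f)$ be a configuration, let $v\in V(G)$ be a vertex that is not a separating vertex of $G$, and let $x_v\in X_v$ be such that $f(x_v)>0$. Let $\mathfrak{C}'=(G',X',H',f')$ be the tuple with $G'=G-v$, $X'$ the restriction of $X$ to $V(G')$, $H'=H[\bigcup_{u\in V(G')}X_u]$, and $$f'(x)=\max\{0,f(x)-\mu_H(x,x_v)\}$$ for all $x\in V(H')$. Then $\mathfrak{C}'$ is a configuration and the following statements hold: (a) If $\mathfrak{C}$ is degree-feasible, then so is $\mathfrak{C}'$. (b) If $\mathfrak{C}$ is uncolorable, then so is $\mathfrak{C}'$.
   Context: $\mathbb{N}_0=\{0,1,2,\dots\}$. Graphs are finite, undirected, may have multiple edges, no loops. $\mu_G(u,v)$ is the number of edges joining $u$ and $v$; $d_G(v)$ is the number of edges incident with $v$. A separating vertex of a connected graph is a vertex whose deletion leaves at least two components; the separating vertices of a disconnected graph are those of its components. A cover of $G$ is a pair $(X,H)$ where $H$ is a graph and $X$ assigns to each $v\in V(G)$ a set $X_v\subseteq V(H)$ such that the sets $X_v$ are pairwise disjoint, $V(H)=\bigcup_v X_v$, each $X_v$ is independent in $H$, and for distinct $u,v\in V(G)$ the set of edges of $H$ between $X_u$ and $X_v$ is the union of $\mu_G(u,v)$ (possibly empty) matchings of $H$. A transversal of $(X,H)$ is a set $T\subseteq V(H)$ with $|T\cap X_v|=1$ for all $v\in V(G)$. A configuration is a tuple $(G,X,H,f)$ where $G$ is a graph, $(X,H)$ is a cover of $G$ and $f:V(H)\to\mathbb{N}_0$.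 It is degree-feasible if $\sum_{x\in X_v}f(x)\ge d_G(v)$ for all $v\in V(G)$. A subgraph $\tilde H$ of $H$ is strictly $f$-degenerate if each non-empty subgraph $H'$ of $\tilde H$ contains a vertex $x$ with $d_{H'}(x)<f(x)$. The configuration is colorable if $(X,H)$ has a transversal $T$ such that $H[T]$ is strictly $f$-degenerate; otherwise it is uncolorable. -}

module Defs where

open import Data.Bool using (if_then_else_)
open import Data.Fin using (Fin; zero; suc)
open import Data.Fin.Properties using (_≟_; any?)
open import Data.Fin.Subset using (Subset; Nonempty; _∈_; _⊆_; _∩_; _-_; ∣_∣)
open import Data.Fin.Subset.Properties using (_∈?_; x∈p∩q⁺; p∩q⊆p; p∩q⊆q)
open import Data.Nat using (ℕ; _+_; _∸_; _≤_; _<_)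
open import Data.Product using (Σ-syntax; ∃; _×_; _,_; proj₁; proj₂)
open import Data.Product.Properties using (≡-dec)
open import Data.Sum using (_⊎_)
open import Data.Vec using ([]; _∷_; tabulate)
open import Data.Vec.Properties using (lookup∘tabulate; []=⇒lookup)
open import Function using (_∘_; _⇔_)
open import Relation.Binary.Construct.Closure.ReflexiveTransitive using (Star)
open import Relation.Binary.PropositionalEquality using (_≡_; _≢_; refl; sym; trans)
open import Relation.Nullary using (¬_; Dec; yes; no; does)
open import Relation.Nullary.Decidable using (_×-dec_; _⊎-dec_)
open import Relation.Unary using (Decidable)

------------------------------------------------------------------------
-- Subsets of Fin n

⟪_⟫ : ∀ {n} {P : Fin n → Set} → Decidable P → Subset n
⟪ P? ⟫ = tabulate (does ∘ P?)

∈⟪⟫⁻ : ∀ {n} {P : Fin n → Set} (P? : Decidable P) {i : Fin n} → i ∈ ⟪ P? ⟫ → P i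
∈⟪⟫⁻ P? {i} i∈ with P? i | trans (sym (lookup∘tabulate (does ∘ P?) i)) ([]=⇒lookup i∈)
... | yes p | _  = p
... | no  _ | ()

⋃[_]_ : ∀ {n k} → Subset n → (Fin n → Subset k) → Subset k
⋃[ S ] X = ⟪ (λ x → any? (λ u → (u ∈? S) ×-dec (x ∈? X u))) ⟫

∑[_]_ : ∀ {n} → Subset n → (Fin n → ℕ) → ℕ
∑[ [] ]    f = 0
∑[ s ∷ S ] f = (if s then f zero else 0) + ∑[ S ] (f ∘ suc)

------------------------------------------------------------------------
-- Finite loopless multigraphs

-- Vertices are drawn from Fin n and edges from Fin m, so that deleting a
-- vertex and passing to a subgraph need no renaming.  The pair ends e is
-- an arbitrary ordering of the two ends of e; it carries no information
-- when e is not in E.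

record Graph (n m : ℕ) : Set where
  field
    V        : Subset n
    E        : Subset m
    ends     : Fin m → Fin n × Fin n
    ends∈V   : ∀ {e} → e ∈ E → proj₁ (ends e) ∈ V × proj₂ (ends e) ∈ V
    loopless : ∀ {e} → e ∈ E → proj₁ (ends e) ≢ proj₂ (ends e)

open Graph public

module _ {n m : ℕ} where

  Joins : Graph n m → Fin n → Fin n → Fin m → Set
  Joins G u v e = ends G e ≡ (u , v) ⊎ ends G e ≡ (v , u)

  joins? : (G : Graph n m) (u v : Fin n) → Decidable (Joins G u v)
  joins? G u v e = ≡-dec _≟_ _≟_ (ends G e) (u , v) ⊎-dec ≡-dec _≟_ _≟_ (ends G e) (v , u)

  Incident : Graph n m → Fin n → Fin m → Set
  Incident G v e = proj₁ (ends G e) ≡ v ⊎ proj₂ (ends G e) ≡ v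

  incident? : (G : Graph n m) (v : Fin n) → Decidable (Incident G v)
  incident? G v e = (proj₁ (ends G e) ≟ v) ⊎-dec (proj₂ (ends G e) ≟ v)

  μ : Graph n m → Fin n → Fin n → ℕ
  μ G u v = ∣ E G ∩ ⟪ joins? G u v ⟫ ∣

  d : Graph n m → Fin n → ℕ
  d G v = ∣ E G ∩ ⟪ incident? G v ⟫ ∣

  record _⊑_ (H′ H : Graph n m) : Set where
    field
      V⊆   : V H′ ⊆ V H
      E⊆   : E H′ ⊆ E H
      ends≡ : ∀ {e} → e ∈ E H′ → ends H′ e ≡ ends H e

  _[_] : Graph n m → Subset n → Graph n m
  G [ S ] = record
    { V        = V G ∩ S
    ; E        = E G ∩ ⟪ inS? ⟫
    ; ends     = ends G
    ; ends∈V   = λ e∈ →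
        let e∈E = p∩q⊆p (E G) ⟪ inS? ⟫ e∈
            e∈S = ∈⟪⟫⁻ inS? (p∩q⊆q (E G) ⟪ inS? ⟫ e∈)
        in  x∈p∩q⁺ (proj₁ (ends∈V G e∈E) , proj₁ e∈S)
          , x∈p∩q⁺ (proj₂ (ends∈V G e∈E) , proj₂ e∈S)
    ; loopless = λ e∈ → loopless G (p∩q⊆p (E G) ⟪ inS? ⟫ e∈)
    }
    where
    inS? : Decidable (λ e → proj₁ (ends G e) ∈ S × proj₂ (ends G e) ∈ S)
    inS? e = (proj₁ (ends G e) ∈? S) ×-dec (proj₂ (ends G e) ∈? S)

  _∖_ : Graph n m → Fin n → Graph n m
  G ∖ v = G [ V G - v ]

  Adjacent : Graph n m → Fin n → Fin n → Set
  Adjacent G u v = ∃ λ e → e ∈ E G × Joins G u v e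

  Connected : Graph n m → Set
  Connected G = Nonempty (V G) × (∀ {u v} → u ∈ V G → v ∈ V G → Star (Adjacent G) u v)

  -- The vertex set of a maximal connected subgraph; such a subgraph is
  -- necessarily induced.
  IsComponent : Graph n m → Subset n → Set
  IsComponent G S =
    S ⊆ V G × Connected (G [ S ]) ×
    (∀ S′ → S ⊆ S′ → S′ ⊆ V G → Connected (G [ S′ ]) → S′ ⊆ S)

  AtLeastTwoComponents : Graph n m → Set
  AtLeastTwoComponents G =
    Σ[ S ∈ Subset n ] Σ[ S′ ∈ Subset n ] (IsComponent G S × IsComponent G S′ × S ≢ S′)

  -- A connected graph is its own only component, so this covers both the
  -- connected and the disconnected case.
  IsSeparating : Graph n m → Fin n → Set
  IsSeparating G v =
    Σ[ S ∈ Subset n ] (IsComponent G S × v ∈ S × AtLeastTwoComponents ((G [ S ]) ∖ v))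

  Independent : Graph n m → Subset n → Set
  Independent G S = ∀ {e} → e ∈ E G → ¬ (proj₁ (ends G e) ∈ S × proj₂ (ends G e) ∈ S)

  IsMatching : Graph n m → Subset m → Set
  IsMatching G M =
    M ⊆ E G ×
    (∀ {e e′} → e ∈ M → e′ ∈ M → e ≢ e′ → ∀ v → ¬ (Incident G v e × Incident G v e′))

  EdgeBetween : Graph n m → Subset n → Subset n → Fin m → Set
  EdgeBetween G A B e =
    e ∈ E G × (∃ λ a → ∃ λ b → a ∈ A × b ∈ B × Joins G a b e)

  StrictlyDegenerate : Graph n m → (Fin n → ℕ) → Set
  StrictlyDegenerate H̃ f =
    ∀ H′ → H′ ⊑ H̃ → Nonempty (V H′) → ∃ λ x → x ∈ V H′ × d H′ x < f x

------------------------------------------------------------------------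
-- Covers and configurations

-- X is total on Fin n, but only its values on V G are ever constrained or
-- used; its restriction to a subset of V G is therefore X itself.

record IsCover {n m k l : ℕ} (G : Graph n m) (H : Graph k l) (X : Fin n → Subset k) : Set where
  field
    X⊆V         : ∀ {v} → v ∈ V G → X v ⊆ V H
    disjoint    : ∀ {u v} → u ∈ V G → v ∈ V G → u ≢ v → ∀ {x} → ¬ (x ∈ X u × x ∈ X v)
    covering    : ∀ {x} → x ∈ V H → ∃ λ v → v ∈ V G × x ∈ X v
    independent : ∀ {v} → v ∈ V G → Independent H (X v)
    matchings   : ∀ {u v} → u ∈ V G → v ∈ V G → u ≢ v →
                  Σ[ M ∈ (Fin (μ G u v) → Subset l) ]
                    ((∀ i → IsMatching H (M i)) ×
                     (∀ e → EdgeBetween H (X u) (X v) e ⇔ (∃ λ i → e ∈ M i)))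

-- A tuple (G , X , H , f), not yet assumed to be a configuration.  As with
-- X, only the values of f on V H matter.

record Tuple (n m k l : ℕ) : Set where
  constructor ⟨_,_,_,_⟩
  field
    G : Graph n m
    X : Fin n → Subset k
    H : Graph k l
    f : Fin k → ℕ

module _ {n m k l : ℕ} where

  IsConfiguration : Tuple n m k l → Set
  IsConfiguration ⟨ G , X , H , f ⟩ = IsCover G H X

  DegreeFeasible : Tuple n m k l → Set
  DegreeFeasible ⟨ G , X , H , f ⟩ = ∀ {v} → v ∈ V G → d G v ≤ ∑[ X v ] f

  IsTransversal : Tuple n m k l → Subset k → Set
  IsTransversal ⟨ G , X , H , f ⟩ T = T ⊆ V H × (∀ {v} → v ∈ V G → ∣ T ∩ X v ∣ ≡ 1)

  Colorable : Tuple n m k l → Set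
  Colorable C@(⟨ G , X , H , f ⟩) =
    Σ[ T ∈ Subset k ] (IsTransversal C T × StrictlyDegenerate (H [ T ]) f)

  Uncolorable : Tuple n m k l → Set
  Uncolorable C = ¬ Colorable C

  -- Truncated subtraction gives max {0, f x − μ H x xᵥ}.
  reduce : Tuple n m k l → Fin n → Fin k → Tuple n m k l
  reduce ⟨ G , X , H , f ⟩ v xᵥ =
    ⟨ G ∖ v , X , H [ ⋃[ V (G ∖ v) ] X ] , (λ x → f x ∸ μ H x xᵥ) ⟩

{-# OPTIONS --safe #-}
module Submission where

-- Extend a transversal T′ of C′ by xᵥ.  A subgraph K of H[T′ ∪ {xᵥ}] other than
-- the single vertex xᵥ has, in K − xᵥ, a vertex x whose degree is less than
-- f x ∸ μ H x xᵥ; restoring xᵥ adds at most μ H x xᵥ to this degree.  For (a),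
-- each of the μ G u v matchings between X u and X v contains at most one edge
-- at xᵥ, so f loses at most μ G u v in total on X u, and this is exactly the
-- number of edges that u loses when v is deleted.

open import Defs
open import Data.Bool using (true; false)
open import Data.Empty using (⊥-elim)
open import Data.Nat using (ℕ; zero; suc; _+_; _∸_; _≤_; _<_; z≤n; s≤s)
open import Data.Nat.Properties hiding (_≟_; suc-injective)
open import Algebra.Properties.CommutativeSemigroup +-commutativeSemigroup using (interchange)
open import Data.Fin using (Fin; zero; suc)
open import Data.Fin.Properties using (_≟_; any?; ¬Fin0; suc-injective)
open import Data.Fin.Subset using (Subset; _∈_; _∉_; _⊆_; _∩_; _∪_; _─_; _-_; ∣_∣; ⁅_⁆; Empty)
open import Data.Fin.Subset.Properties
open import Data.Product using (_×_; _,_; proj₁; proj₂; ∃; map₂)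
open import Data.Product.Properties using (,-injectiveˡ; ,-injectiveʳ)
open import Data.Sum using (_⊎_; inj₁; inj₂; swap; [_,_]′)
open import Data.Vec using ([]; _∷_; here; there)
open import Data.Vec.Properties using (lookup∘tabulate; lookup⇒[]=)
open import Function using (_∘_; _⇔_; mk⇔; Equivalence)
open import Relation.Binary.PropositionalEquality using (_≡_; _≢_; refl; sym; trans; cong; subst)
open import Relation.Nullary using (¬_; yes; no; does)
open import Relation.Nullary.Decidable using (dec-true; _×-dec_)
open import Relation.Unary using (Decidable)

private
  variable
    n m k l : ℕ

m<n∸o⇒m+o<n : ∀ m n o → m < n ∸ o → m + o < n
m<n∸o⇒m+o<n m n       zero    lt rewrite +-identityʳ m = lt
m<n∸o⇒m+o<n m (suc n) (suc o) lt rewrite +-suc m o = s≤s (m<n∸o⇒m+o<n m n o lt)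

-- Subsets of Fin n

∈⟪⟫⁺ : {P : Fin n → Set} (P? : Decidable P) {i : Fin n} → P i → i ∈ ⟪ P? ⟫
∈⟪⟫⁺ P? {i} p = lookup⇒[]= i _ (trans (lookup∘tabulate (does ∘ P?) i) (dec-true (P? i) p))

∈⋃⁺ : (S : Subset n) (X : Fin n → Subset k) {u : Fin n} {x : Fin k} →
      u ∈ S → x ∈ X u → x ∈ ⋃[ S ] X
∈⋃⁺ S X u∈ x∈ = ∈⟪⟫⁺ (λ x → any? (λ u → (u ∈? S) ×-dec (x ∈? X u))) (_ , u∈ , x∈)

∈⋃⁻ : (S : Subset n) (X : Fin n → Subset k) {x : Fin k} →
      x ∈ ⋃[ S ] X → ∃ λ u → u ∈ S × x ∈ X u
∈⋃⁻ S X = ∈⟪⟫⁻ (λ x → any? (λ u → (u ∈? S) ×-dec (x ∈? X u)))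

x∈p─q⇒x∉q : (p q : Subset n) {x : Fin n} → x ∈ p ─ q → x ∉ q
x∈p─q⇒x∉q (true ∷ p)  (false ∷ q) here       ()
x∈p─q⇒x∉q (_ ∷ p)     (_ ∷ q)     (there x∈) (there x∈q) = x∈p─q⇒x∉q p q x∈ x∈q

x∈p-y⇒x≢y : (p : Subset n) {x : Fin n} (y : Fin n) → x ∈ p - y → x ≢ y
x∈p-y⇒x≢y p y x∈ refl = x∈p─q⇒x∉q p ⁅ y ⁆ x∈ (x∈⁅x⁆ y)

Empty⇒∣p∣≡0 : {p : Subset n} → Empty p → ∣ p ∣ ≡ 0
Empty⇒∣p∣≡0 {n = n} p∅ = trans (cong ∣_∣ (Empty-unique p∅)) (∣⊥∣≡0 n)

∣p∪q∣+∣p∩q∣≡∣p∣+∣q∣ : (p q : Subset n) → ∣ p ∪ q ∣ + ∣ p ∩ q ∣ ≡ ∣ p ∣ + ∣ q ∣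
∣p∪q∣+∣p∩q∣≡∣p∣+∣q∣ []          []          = refl
∣p∪q∣+∣p∩q∣≡∣p∣+∣q∣ (true  ∷ p) (true  ∷ q) =
  cong suc (trans (+-suc _ _) (trans (cong suc (∣p∪q∣+∣p∩q∣≡∣p∣+∣q∣ p q)) (sym (+-suc _ _))))
∣p∪q∣+∣p∩q∣≡∣p∣+∣q∣ (true  ∷ p) (false ∷ q) = cong suc (∣p∪q∣+∣p∩q∣≡∣p∣+∣q∣ p q)
∣p∪q∣+∣p∩q∣≡∣p∣+∣q∣ (false ∷ p) (true  ∷ q) =
  trans (cong suc (∣p∪q∣+∣p∩q∣≡∣p∣+∣q∣ p q)) (sym (+-suc _ _))
∣p∪q∣+∣p∩q∣≡∣p∣+∣q∣ (false ∷ p) (false ∷ q) = ∣p∪q∣+∣p∩q∣≡∣p∣+∣q∣ p q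

∣p∪q∣≤∣p∣+∣q∣ : (p q : Subset n) → ∣ p ∪ q ∣ ≤ ∣ p ∣ + ∣ q ∣
∣p∪q∣≤∣p∣+∣q∣ p q = ≤-trans (m≤m+n _ _) (≤-reflexive (∣p∪q∣+∣p∩q∣≡∣p∣+∣q∣ p q))

disjoint⇒∣p∣+∣q∣≤∣r∣ : {p q r : Subset n} → (∀ {x} → x ∈ p → x ∉ q) →
                       p ⊆ r → q ⊆ r → ∣ p ∣ + ∣ q ∣ ≤ ∣ r ∣
disjoint⇒∣p∣+∣q∣≤∣r∣ {p = p} {q} {r} p∥q p⊆r q⊆r = begin
  ∣ p ∣ + ∣ q ∣         ≡⟨ ∣p∪q∣+∣p∩q∣≡∣p∣+∣q∣ p q ⟨
  ∣ p ∪ q ∣ + ∣ p ∩ q ∣ ≡⟨ cong (∣ p ∪ q ∣ +_) (Empty⇒∣p∣≡0 p∩q∅) ⟩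
  ∣ p ∪ q ∣ + 0         ≡⟨ +-identityʳ _ ⟩
  ∣ p ∪ q ∣             ≤⟨ p⊆q⇒∣p∣≤∣q∣ ([ p⊆r , q⊆r ]′ ∘ x∈p∪q⁻ p q) ⟩
  ∣ r ∣                 ∎
  where
  open ≤-Reasoning
  p∩q∅ : Empty (p ∩ q)
  p∩q∅ (_ , x∈) with x∈p , x∈q ← x∈p∩q⁻ p q x∈ = p∥q x∈p x∈q

subsingleton⇒∣p∣≤1 : (p : Subset n) → (∀ {x y} → x ∈ p → y ∈ p → x ≡ y) → ∣ p ∣ ≤ 1
subsingleton⇒∣p∣≤1 p uniq with nonempty? p
... | no  p∅       = ≤-trans (≤-reflexive (Empty⇒∣p∣≡0 p∅)) z≤n
... | yes (x , x∈) = ≤-trans (p⊆q⇒∣p∣≤∣q∣ λ y∈ → subst (_∈ ⁅ x ⁆) (uniq x∈ y∈) (x∈⁅x⁆ x))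
                             (≤-reflexive (∣⁅x⁆∣≡1 x))

covered⇒∣p∣≤k : (p : Subset n) (M : Fin k → Subset n) →
                (∀ {x} → x ∈ p → ∃ λ i → x ∈ M i) →
                (∀ i {x y} → x ∈ p → y ∈ p → x ∈ M i → y ∈ M i → x ≡ y) →
                ∣ p ∣ ≤ k
covered⇒∣p∣≤k {k = zero} p M cov uniq = ≤-reflexive (Empty⇒∣p∣≡0 λ (_ , x∈) → ¬Fin0 (proj₁ (cov x∈)))
covered⇒∣p∣≤k {k = suc k} p M cov uniq = begin
  ∣ p ∣                             ≤⟨ p⊆q⇒∣p∣≤∣q∣ split ⟩
  ∣ (p ∩ M zero) ∪ (p ─ M zero) ∣   ≤⟨ ∣p∪q∣≤∣p∣+∣q∣ (p ∩ M zero) (p ─ M zero) ⟩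
  ∣ p ∩ M zero ∣ + ∣ p ─ M zero ∣   ≤⟨ +-mono-≤ (subsingleton⇒∣p∣≤1 _ uniq₀) rest ⟩
  suc k                             ∎
  where
  open ≤-Reasoning
  split : p ⊆ (p ∩ M zero) ∪ (p ─ M zero)
  split {x} x∈ with x ∈? M zero
  ... | yes x∈M = x∈p∪q⁺ (inj₁ (x∈p∩q⁺ (x∈ , x∈M)))
  ... | no  x∉M = x∈p∪q⁺ (inj₂ (x∈p∧x∉q⇒x∈p─q x∈ x∉M))
  uniq₀ : ∀ {x y} → x ∈ p ∩ M zero → y ∈ p ∩ M zero → x ≡ y
  uniq₀ x∈ y∈ with x∈p , x∈M ← x∈p∩q⁻ p (M zero) x∈ | y∈p , y∈M ← x∈p∩q⁻ p (M zero) y∈ =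
    uniq zero x∈p y∈p x∈M y∈M
  cov′ : ∀ {x} → x ∈ p ─ M zero → ∃ λ i → x ∈ M (suc i)
  cov′ x∈ with cov (p─q⊆p p (M zero) x∈)
  ... | zero  , x∈M = ⊥-elim (x∈p─q⇒x∉q p (M zero) x∈ x∈M)
  ... | suc i , x∈M = i , x∈M
  rest : ∣ p ─ M zero ∣ ≤ k
  rest = covered⇒∣p∣≤k (p ─ M zero) (M ∘ suc) cov′
    λ i x∈ y∈ → uniq (suc i) (p─q⊆p p (M zero) x∈) (p─q⊆p p (M zero) y∈)

∑-mono-≤ : (S : Subset n) {f g : Fin n → ℕ} → (∀ x → f x ≤ g x) → ∑[ S ] f ≤ ∑[ S ] g
∑-mono-≤ []          f≤g = z≤n
∑-mono-≤ (true  ∷ S) f≤g = +-mono-≤ (f≤g zero) (∑-mono-≤ S (f≤g ∘ suc))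
∑-mono-≤ (false ∷ S) f≤g = ∑-mono-≤ S (f≤g ∘ suc)

∑-distrib-+ : (S : Subset n) (f g : Fin n → ℕ) → ∑[ S ] (λ x → f x + g x) ≡ ∑[ S ] f + ∑[ S ] g
∑-distrib-+ []          f g = refl
∑-distrib-+ (true  ∷ S) f g =
  trans (cong (f zero + g zero +_) (∑-distrib-+ S (f ∘ suc) (g ∘ suc)))
        (interchange (f zero) (g zero) (∑[ S ] (f ∘ suc)) (∑[ S ] (g ∘ suc)))
∑-distrib-+ (false ∷ S) f g = ∑-distrib-+ S (f ∘ suc) (g ∘ suc)

∑∣∣≤∣⋃∣ : (S : Subset n) (A : Fin n → Subset k) →
          (∀ {x y e} → e ∈ A x → e ∈ A y → x ≡ y) →
          ∑[ S ] (∣_∣ ∘ A) ≤ ∣ ⋃[ S ] A ∣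
∑∣∣≤∣⋃∣ []      A dis = z≤n
∑∣∣≤∣⋃∣ (s ∷ S) A dis = bound s
  where
  tail-⊆ : ∀ s → ⋃[ S ] (A ∘ suc) ⊆ ⋃[ s ∷ S ] A
  tail-⊆ s e∈ with _ , x∈ , e∈A ← ∈⋃⁻ S (A ∘ suc) e∈ = ∈⋃⁺ (s ∷ S) A (there x∈) e∈A
  rest : ∑[ S ] (∣_∣ ∘ A ∘ suc) ≤ ∣ ⋃[ S ] (A ∘ suc) ∣
  rest = ∑∣∣≤∣⋃∣ S (A ∘ suc) λ e∈ e∈′ → suc-injective (dis e∈ e∈′)
  head-disjoint : ∀ {e} → e ∈ A zero → e ∉ ⋃[ S ] (A ∘ suc)
  head-disjoint e∈₀ e∈ with _ , _ , e∈A ← ∈⋃⁻ S (A ∘ suc) e∈ with () ← dis e∈₀ e∈A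
  bound : ∀ s → ∑[ s ∷ S ] (∣_∣ ∘ A) ≤ ∣ ⋃[ s ∷ S ] A ∣
  bound true  = ≤-trans (+-monoʳ-≤ ∣ A zero ∣ rest)
    (disjoint⇒∣p∣+∣q∣≤∣r∣ head-disjoint (∈⋃⁺ (true ∷ S) A here) (tail-⊆ true))
  bound false = ≤-trans rest (p⊆q⇒∣p∣≤∣q∣ (tail-⊆ false))

-- Multigraphs

EndsIn : Graph n m → Subset n → Fin m → Set
EndsIn G S e = proj₁ (ends G e) ∈ S × proj₂ (ends G e) ∈ S

-- Unfolds to the decision procedure hidden in the definition of G [ S ].
endsIn? : (G : Graph n m) (S : Subset n) → Decidable (EndsIn G S)
endsIn? G S e = (proj₁ (ends G e) ∈? S) ×-dec (proj₂ (ends G e) ∈? S)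

∈E[]⁺ : (G : Graph n m) (S : Subset n) {e : Fin m} → e ∈ E G → EndsIn G S e → e ∈ E (G [ S ])
∈E[]⁺ G S e∈ eS = x∈p∩q⁺ (e∈ , ∈⟪⟫⁺ (endsIn? G S) eS)

∈E[]⁻ : (G : Graph n m) (S : Subset n) {e : Fin m} → e ∈ E (G [ S ]) → e ∈ E G × EndsIn G S e
∈E[]⁻ G S e∈ = map₂ (∈⟪⟫⁻ (endsIn? G S)) (x∈p∩q⁻ (E G) ⟪ endsIn? G S ⟫ e∈)

∈V∖⁺ : (G : Graph n m) {u v : Fin n} → u ∈ V G → u ≢ v → u ∈ V (G ∖ v)
∈V∖⁺ G u∈ u≢v = x∈p∩q⁺ (u∈ , x∈p∧x≢y⇒x∈p-y u∈ u≢v)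

∈V∖⁻ : (G : Graph n m) {u v : Fin n} → u ∈ V (G ∖ v) → u ∈ V G × u ≢ v
∈V∖⁻ G {v = v} u∈ = map₂ (x∈p-y⇒x≢y (V G) v) (x∈p∩q⁻ (V G) (V G - v) u∈)

∈E∩⁺ : (G : Graph n m) {P : Fin m → Set} (P? : Decidable P) {e : Fin m} →
       e ∈ E G → P e → e ∈ E G ∩ ⟪ P? ⟫
∈E∩⁺ G P? e∈ p = x∈p∩q⁺ (e∈ , ∈⟪⟫⁺ P? p)

∈E∩⁻ : (G : Graph n m) {P : Fin m → Set} (P? : Decidable P) {e : Fin m} →
       e ∈ E G ∩ ⟪ P? ⟫ → e ∈ E G × P e
∈E∩⁻ G P? e∈ = map₂ (∈⟪⟫⁻ P?) (x∈p∩q⁻ (E G) ⟪ P? ⟫ e∈)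

joins-incidentˡ : (G : Graph n m) {u v : Fin n} {e : Fin m} → Joins G u v e → Incident G u e
joins-incidentˡ G (inj₁ eq) = inj₁ (,-injectiveˡ eq)
joins-incidentˡ G (inj₂ eq) = inj₂ (,-injectiveʳ eq)

joins-incidentʳ : (G : Graph n m) {u v : Fin n} {e : Fin m} → Joins G u v e → Incident G v e
joins-incidentʳ G = joins-incidentˡ G ∘ swap

joins-injectiveˡ : (G : Graph n m) {u u′ v : Fin n} {e : Fin m} →
                   Joins G u v e → Joins G u′ v e → u ≡ u′
joins-injectiveˡ G (inj₁ p) (inj₁ q) = ,-injectiveˡ (trans (sym p) q)
joins-injectiveˡ G (inj₂ p) (inj₂ q) = ,-injectiveʳ (trans (sym p) q)
joins-injectiveˡ G (inj₁ p) (inj₂ q) with refl ← trans (sym p) q = refl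
joins-injectiveˡ G (inj₂ p) (inj₁ q) with refl ← trans (sym p) q = refl

joins⇒endsIn : (G : Graph n m) {S : Subset n} {u v : Fin n} {e : Fin m} →
               u ∈ S → v ∈ S → Joins G u v e → EndsIn G S e
joins⇒endsIn G {S} u∈ v∈ (inj₁ eq) rewrite eq = u∈ , v∈
joins⇒endsIn G {S} u∈ v∈ (inj₂ eq) rewrite eq = v∈ , u∈

incident-endsIn : (G : Graph n m) {S : Subset n} {v : Fin n} {e : Fin m} →
                  Incident G v e → EndsIn G S e → v ∈ S
incident-endsIn G (inj₁ refl) = proj₁
incident-endsIn G (inj₂ refl) = proj₂

incident-both⇒joins : (G : Graph n m) {u v : Fin n} {e : Fin m} → u ≢ v →
                      Incident G u e → Incident G v e → Joins G u v e
incident-both⇒joins G u≢v (inj₁ refl) (inj₁ refl) = ⊥-elim (u≢v refl)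
incident-both⇒joins G u≢v (inj₁ refl) (inj₂ refl) = inj₁ refl
incident-both⇒joins G u≢v (inj₂ refl) (inj₁ refl) = inj₂ refl
incident-both⇒joins G u≢v (inj₂ refl) (inj₂ refl) = ⊥-elim (u≢v refl)

endsIn-V-v : (G : Graph n m) {v : Fin n} {e : Fin m} → e ∈ E G → ¬ Incident G v e →
             EndsIn G (V G - v) e
endsIn-V-v G e∈ ¬inc =
    x∈p∧x≢y⇒x∈p-y (proj₁ (ends∈V G e∈)) (¬inc ∘ inj₁)
  , x∈p∧x≢y⇒x∈p-y (proj₂ (ends∈V G e∈)) (¬inc ∘ inj₂)

μ-[] : (G : Graph n m) (S : Subset n) {u v : Fin n} → u ∈ S → v ∈ S → μ (G [ S ]) u v ≡ μ G u v
μ-[] G S {u} {v} u∈ v∈ = cong ∣_∣ (⊆-antisym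
  (λ e∈ → let e∈E , j = ∈E∩⁻ (G [ S ]) (joins? G u v) e∈ in
          ∈E∩⁺ G (joins? G u v) (proj₁ (∈E[]⁻ G S e∈E)) j)
  (λ e∈ → let e∈E , j = ∈E∩⁻ G (joins? G u v) e∈ in
          ∈E∩⁺ (G [ S ]) (joins? G u v) (∈E[]⁺ G S e∈E (joins⇒endsIn G u∈ v∈ j)) j))

μ+d-∖≤d : (G : Graph n m) (u v : Fin n) → μ G u v + d (G ∖ v) u ≤ d G u
μ+d-∖≤d G u v = disjoint⇒∣p∣+∣q∣≤∣r∣
  (λ e∈ e∈′ →
    let _ , j    = ∈E∩⁻ G (joins? G u v) e∈
        e∈E′ , _ = ∈E∩⁻ (G ∖ v) (incident? G u) e∈′
        _ , eS   = ∈E[]⁻ G (V G - v) e∈E′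
    in  x∈p-y⇒x≢y (V G) v (incident-endsIn G (joins-incidentʳ G j) eS) refl)
  (λ e∈ → let e∈E , j = ∈E∩⁻ G (joins? G u v) e∈ in
          ∈E∩⁺ G (incident? G u) e∈E (joins-incidentˡ G j))
  (λ e∈ → let e∈E , inc = ∈E∩⁻ (G ∖ v) (incident? G u) e∈ in
          ∈E∩⁺ G (incident? G u) (proj₁ (∈E[]⁻ G (V G - v) e∈E)) inc)

d≤d-∖+μ : (G : Graph n m) {u v : Fin n} → u ≢ v → d G u ≤ d (G ∖ v) u + μ G u v
d≤d-∖+μ G {u} {v} u≢v = ≤-trans (p⊆q⇒∣p∣≤∣q∣ split)
  (∣p∪q∣≤∣p∣+∣q∣ (E (G ∖ v) ∩ ⟪ incident? G u ⟫) (E G ∩ ⟪ joins? G u v ⟫))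
  where
  split : E G ∩ ⟪ incident? G u ⟫ ⊆
          (E (G ∖ v) ∩ ⟪ incident? G u ⟫) ∪ (E G ∩ ⟪ joins? G u v ⟫)
  split {e} e∈ with e∈E , inc ← ∈E∩⁻ G (incident? G u) e∈ with incident? G v e
  ... | yes incᵥ = x∈p∪q⁺ (inj₂ (∈E∩⁺ G (joins? G u v) e∈E (incident-both⇒joins G u≢v inc incᵥ)))
  ... | no ¬incᵥ = x∈p∪q⁺ (inj₁ (∈E∩⁺ (G ∖ v) (incident? G u)
                     (∈E[]⁺ G (V G - v) e∈E (endsIn-V-v G e∈E ¬incᵥ)) inc))

d≡0 : (G : Graph n m) {v : Fin n} → (∀ {u} → u ∈ V G → u ≡ v) → d G v ≡ 0
d≡0 G {v} only = Empty⇒∣p∣≡0 λ (_ , e∈) →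
  let e∈E , _ = ∈E∩⁻ G (incident? G v) e∈
      p , q   = ends∈V G e∈E
  in  loopless G e∈E (trans (only p) (sym (only q)))

μ-mono-⊑ : {K H : Graph n m} → K ⊑ H → (u v : Fin n) → μ K u v ≤ μ H u v
μ-mono-⊑ {K = K} {H} K⊑H u v = p⊆q⇒∣p∣≤∣q∣ λ e∈ →
  let e∈E , j = ∈E∩⁻ K (joins? K u v) e∈ in
  ∈E∩⁺ H (joins? H u v) (E⊆ e∈E)
    (subst (λ p → p ≡ (u , v) ⊎ p ≡ (v , u)) (ends≡ e∈E) j)
  where open _⊑_ K⊑H

[]-⊑ : (G : Graph n m) (S : Subset n) → (G [ S ]) ⊑ G
[]-⊑ G S = record
  { V⊆ = p∩q⊆p (V G) S ; E⊆ = proj₁ ∘ ∈E[]⁻ G S ; ends≡ = λ _ → refl }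

⊑-trans : {F G H : Graph n m} → F ⊑ G → G ⊑ H → F ⊑ H
⊑-trans F⊑G G⊑H = record
  { V⊆    = _⊑_.V⊆ G⊑H ∘ _⊑_.V⊆ F⊑G
  ; E⊆    = _⊑_.E⊆ G⊑H ∘ _⊑_.E⊆ F⊑G
  ; ends≡ = λ e∈ → trans (_⊑_.ends≡ F⊑G e∈) (_⊑_.ends≡ G⊑H (_⊑_.E⊆ F⊑G e∈))
  }

⊑[]⁺ : {K H : Graph n m} (S : Subset n) → K ⊑ H → V K ⊆ S → K ⊑ (H [ S ])
⊑[]⁺ {K = K} {H} S K⊑H VK⊆S = record
  { V⊆    = λ x∈ → x∈p∩q⁺ (V⊆ x∈ , VK⊆S x∈)
  ; E⊆    = λ e∈ → ∈E[]⁺ H S (E⊆ e∈)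
      (subst (λ p → proj₁ p ∈ S × proj₂ p ∈ S) (ends≡ e∈)
        (VK⊆S (proj₁ (ends∈V K e∈)) , VK⊆S (proj₂ (ends∈V K e∈))))
  ; ends≡ = ends≡
  }
  where open _⊑_ K⊑H

strictlyDegenerate-extend : (H : Graph n m) (f : Fin n → ℕ) (S : Subset n) (y : Fin n) →
  0 < f y →
  StrictlyDegenerate (H [ S ]) (λ x → f x ∸ μ H x y) →
  StrictlyDegenerate (H [ S ∪ ⁅ y ⁆ ]) f
strictlyDegenerate-extend H f S y fy>0 deg K K⊑ (z , z∈) with nonempty? (V (K ∖ y))
... | no  K-y∅ = y , subst (_∈ V K) (only z∈) z∈
                   , subst (_< f y) (sym (d≡0 K only)) fy>0
  where
  only : ∀ {u} → u ∈ V K → u ≡ y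
  only {u} u∈ with u ≟ y
  ... | yes u≡y = u≡y
  ... | no  u≢y = ⊥-elim (K-y∅ (u , ∈V∖⁺ K u∈ u≢y))
... | yes K-y≠∅ = x , x∈K , bound
  where
  K⊑H : K ⊑ H
  K⊑H = ⊑-trans K⊑ ([]-⊑ H (S ∪ ⁅ y ⁆))
  V⊆S : V (K ∖ y) ⊆ S
  V⊆S u∈ with u∈K , u≢y ← ∈V∖⁻ K u∈
         with x∈p∪q⁻ S ⁅ y ⁆ (p∩q⊆q (V H) (S ∪ ⁅ y ⁆) (_⊑_.V⊆ K⊑ u∈K))
  ... | inj₁ u∈S = u∈S
  ... | inj₂ u∈y = ⊥-elim (u≢y (x∈⁅y⁆⇒x≡y y u∈y))
  found : ∃ λ x → x ∈ V (K ∖ y) × d (K ∖ y) x < f x ∸ μ H x y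
  found = deg (K ∖ y) (⊑[]⁺ S (⊑-trans ([]-⊑ K (V K - y)) K⊑H) V⊆S) K-y≠∅
  x   = proj₁ found
  x∈K = proj₁ (∈V∖⁻ K (proj₁ (proj₂ found)))
  x≢y = proj₂ (∈V∖⁻ K (proj₁ (proj₂ found)))
  bound : d K x < f x
  bound = begin-strict
    d K x                    ≤⟨ d≤d-∖+μ K x≢y ⟩
    d (K ∖ y) x + μ K x y    ≤⟨ +-monoʳ-≤ (d (K ∖ y) x) (μ-mono-⊑ K⊑H x y) ⟩
    d (K ∖ y) x + μ H x y    <⟨ m<n∸o⇒m+o<n _ (f x) (μ H x y) (proj₂ (proj₂ found)) ⟩
    f x                      ∎
    where
    open ≤-Reasoning

-- Covers

∑μ≤μ : {G : Graph n m} {H : Graph k l} {X : Fin n → Subset k} → IsCover G H X →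
       {u v : Fin n} → u ∈ V G → v ∈ V G → u ≢ v → {y : Fin k} → y ∈ X v →
       ∑[ X u ] (λ x → μ H x y) ≤ μ G u v
∑μ≤μ {G = G} {H} {X} cover {u} {v} u∈ v∈ u≢v {y} y∈ =
  let M , matching , union = IsCover.matchings cover u∈ v∈ u≢v in
  ≤-trans (∑∣∣≤∣⋃∣ (X u) at-y disjoint) (covered⇒∣p∣≤k (⋃[ X u ] at-y) M
    (λ {e} e∈ → let x , x∈ , e∈E , j = unpack e∈ in
                Equivalence.to (union e) (e∈E , x , y , x∈ , y∈ , j))
    (λ i {e} {e′} e∈ e∈′ e∈M e′∈M → matched (matching i) e∈M e′∈M (incident-y e∈) (incident-y e∈′)))
  where
  at-y : _ → Subset _
  at-y x = E H ∩ ⟪ joins? H x y ⟫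
  disjoint : ∀ {x x′ e} → e ∈ at-y x → e ∈ at-y x′ → x ≡ x′
  disjoint e∈ e∈′ = joins-injectiveˡ H (proj₂ (∈E∩⁻ H (joins? H _ y) e∈))
                                       (proj₂ (∈E∩⁻ H (joins? H _ y) e∈′))
  unpack : ∀ {e} → e ∈ ⋃[ X u ] at-y → ∃ λ x → x ∈ X u × e ∈ E H × Joins H x y e
  unpack e∈ = map₂ (map₂ (∈E∩⁻ H (joins? H _ y))) (∈⋃⁻ (X u) at-y e∈)
  incident-y : ∀ {e} → e ∈ ⋃[ X u ] at-y → Incident H y e
  incident-y e∈ = joins-incidentʳ H (proj₂ (proj₂ (proj₂ (unpack e∈))))
  matched : ∀ {M e e′} → IsMatching H M → e ∈ M → e′ ∈ M →
            Incident H y e → Incident H y e′ → e ≡ e′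
  matched {e = e} {e′} (_ , mat) e∈ e′∈ inc inc′ with e ≟ e′
  ... | yes e≡e′ = e≡e′
  ... | no  e≢e′ = ⊥-elim (mat e∈ e′∈ e≢e′ y (inc , inc′))

cover-[] : {G : Graph n m} {H : Graph k l} {X : Fin n → Subset k} (S : Subset n) →
           IsCover G H X → IsCover (G [ S ]) (H [ ⋃[ V (G [ S ]) ] X ]) X
cover-[] {G = G} {H} {X} S cover = record
  { X⊆V         = λ u∈ x∈ → x∈p∩q⁺ (X⊆V (∈V u∈) x∈ , X⊆U u∈ x∈)
  ; disjoint    = λ u∈ v∈ → disjoint (∈V u∈) (∈V v∈)
  ; covering    = λ x∈ → ∈⋃⁻ (V (G [ S ])) X (p∩q⊆q (V H) U x∈)
  ; independent = λ u∈ e∈ → independent (∈V u∈) (proj₁ (∈E[]⁻ H U e∈))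
  ; matchings   = λ {u} {v} u∈ v∈ u≢v →
      subst (λ r → ∃ λ (M : Fin r → Subset _) →
               (∀ i → IsMatching H′ (M i)) ×
               (∀ e → EdgeBetween H′ (X u) (X v) e ⇔ (∃ λ i → e ∈ M i)))
        (sym (μ-[] G S (p∩q⊆q (V G) S u∈) (p∩q⊆q (V G) S v∈)))
        (matchings′ u∈ v∈ u≢v)
  }
  where
  open IsCover cover
  U  = ⋃[ V (G [ S ]) ] X
  H′ = H [ U ]
  ∈V : ∀ {u} → u ∈ V (G [ S ]) → u ∈ V G
  ∈V = p∩q⊆p (V G) S
  X⊆U : ∀ {u} → u ∈ V (G [ S ]) → X u ⊆ U
  X⊆U u∈ = ∈⋃⁺ (V (G [ S ])) X u∈
  matchings′ : ∀ {u v} → u ∈ V (G [ S ]) → v ∈ V (G [ S ]) → u ≢ v →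
    ∃ λ (M : Fin (μ G u v) → Subset _) →
      (∀ i → IsMatching H′ (M i)) ×
      (∀ e → EdgeBetween H′ (X u) (X v) e ⇔ (∃ λ i → e ∈ M i))
  matchings′ {u} {v} u∈ v∈ u≢v with M , matching , union ← matchings (∈V u∈) (∈V v∈) u≢v =
      M
    , (λ i → (λ e∈ → proj₁ (restrict (Equivalence.from (union _) (i , e∈)))) , proj₂ (matching i))
    , λ e → mk⇔ (λ (e∈ , between) → Equivalence.to (union e) (proj₁ (∈E[]⁻ H U e∈) , between))
                (restrict ∘ Equivalence.from (union e))
    where
    restrict : ∀ {e} → EdgeBetween H (X u) (X v) e → EdgeBetween H′ (X u) (X v) e
    restrict (e∈ , between@(_ , _ , a∈ , b∈ , j)) =
      ∈E[]⁺ H U e∈ (joins⇒endsIn H (X⊆U u∈ a∈) (X⊆U v∈ b∈) j) , between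

module _ (G : Graph n m) (X : Fin n → Subset k) (H : Graph k l) (f : Fin k → ℕ)
         (cover : IsCover G H X) (v : Fin n) (v∈ : v ∈ V G) (xᵥ : Fin k) (xᵥ∈ : xᵥ ∈ X v)
         where

  private
    C  = ⟨ G , X , H , f ⟩
    C′ = reduce C v xᵥ
    U  = ⋃[ V (G ∖ v) ] X
    f′ = Tuple.f C′

  reduce-degreeFeasible : DegreeFeasible C → DegreeFeasible C′
  reduce-degreeFeasible feasible {u} u∈′ with u∈ , u≢v ← ∈V∖⁻ G u∈′ =
    +-cancelˡ-≤ (μ G u v) _ _ (begin
      μ G u v + d (G ∖ v) u                    ≤⟨ μ+d-∖≤d G u v ⟩
      d G u                                    ≤⟨ feasible u∈ ⟩
      ∑[ X u ] f                               ≤⟨ ∑-mono-≤ (X u) (λ x → m≤n+m∸n (f x) (μ H x xᵥ)) ⟩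
      ∑[ X u ] (λ x → μ H x xᵥ + f′ x)         ≡⟨ ∑-distrib-+ (X u) (λ x → μ H x xᵥ) f′ ⟩
      ∑[ X u ] (λ x → μ H x xᵥ) + ∑[ X u ] f′  ≤⟨ +-monoˡ-≤ (∑[ X u ] f′) (∑μ≤μ cover u∈ v∈ u≢v xᵥ∈) ⟩
      μ G u v + ∑[ X u ] f′                    ∎)
    where open ≤-Reasoning

  reduce-colorable : 0 < f xᵥ → Colorable C′ → Colorable C
  reduce-colorable fxᵥ>0 (T , (T⊆ , T-trans) , degenerate) =
      T ∪ ⁅ xᵥ ⁆
    , ( [ p∩q⊆p (V H) U ∘ T⊆ , (λ x∈ → subst (_∈ V H) (sym (x∈⁅y⁆⇒x≡y xᵥ x∈)) (X⊆V v∈ xᵥ∈)) ]′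
          ∘ x∈p∪q⁻ T ⁅ xᵥ ⁆
      , meets )
    , strictlyDegenerate-extend H f T xᵥ fxᵥ>0 degenerateᴴ
    where
    open IsCover cover
    T-avoids-Xᵥ : ∀ {x} → x ∈ T → x ∉ X v
    T-avoids-Xᵥ x∈T x∈Xᵥ
      with u , u∈′ , x∈Xᵤ ← ∈⋃⁻ (V (G ∖ v)) X (p∩q⊆q (V H) U (T⊆ x∈T))
      with u∈ , u≢v ← ∈V∖⁻ G u∈′ = disjoint u∈ v∈ u≢v (x∈Xᵤ , x∈Xᵥ)
    degenerateᴴ : StrictlyDegenerate (H [ T ]) f′
    degenerateᴴ K K⊑ = degenerate K
      (⊑[]⁺ T (⊑[]⁺ U (⊑-trans K⊑ ([]-⊑ H T)) (p∩q⊆q (V H) U ∘ T⊆ ∘ V⊆T)) V⊆T)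
      where
      V⊆T : V K ⊆ T
      V⊆T = p∩q⊆q (V H) T ∘ _⊑_.V⊆ K⊑
    meets : ∀ {u} → u ∈ V G → ∣ (T ∪ ⁅ xᵥ ⁆) ∩ X u ∣ ≡ 1
    meets {u} u∈ with u ≟ v
    ... | yes refl = trans (cong ∣_∣ (⊆-antisym ⊆xᵥ xᵥ⊆)) (∣⁅x⁆∣≡1 xᵥ)
      where
      ⊆xᵥ : (T ∪ ⁅ xᵥ ⁆) ∩ X v ⊆ ⁅ xᵥ ⁆
      ⊆xᵥ x∈ with x∈T∪ , x∈X ← x∈p∩q⁻ (T ∪ ⁅ xᵥ ⁆) (X v) x∈ with x∈p∪q⁻ T ⁅ xᵥ ⁆ x∈T∪
      ... | inj₁ x∈T  = ⊥-elim (T-avoids-Xᵥ x∈T x∈X)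
      ... | inj₂ x∈xᵥ = x∈xᵥ
      xᵥ⊆ : ⁅ xᵥ ⁆ ⊆ (T ∪ ⁅ xᵥ ⁆) ∩ X v
      xᵥ⊆ x∈ = x∈p∩q⁺ (x∈p∪q⁺ (inj₂ x∈) , subst (_∈ X v) (sym (x∈⁅y⁆⇒x≡y xᵥ x∈)) xᵥ∈)
    ... | no u≢v = trans (cong ∣_∣ (⊆-antisym ⊆T T⊆′)) (T-trans (∈V∖⁺ G u∈ u≢v))
      where
      ⊆T : (T ∪ ⁅ xᵥ ⁆) ∩ X u ⊆ T ∩ X u
      ⊆T x∈ with x∈T∪ , x∈X ← x∈p∩q⁻ (T ∪ ⁅ xᵥ ⁆) (X u) x∈ with x∈p∪q⁻ T ⁅ xᵥ ⁆ x∈T∪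
      ... | inj₁ x∈T  = x∈p∩q⁺ (x∈T , x∈X)
      ... | inj₂ x∈xᵥ = ⊥-elim (disjoint u∈ v∈ u≢v
                          (subst (_∈ X u) (x∈⁅y⁆⇒x≡y xᵥ x∈xᵥ) x∈X , xᵥ∈))
      T⊆′ : T ∩ X u ⊆ (T ∪ ⁅ xᵥ ⁆) ∩ X u
      T⊆′ x∈ with x∈T , x∈X ← x∈p∩q⁻ T (X u) x∈ = x∈p∩q⁺ (x∈p∪q⁺ (inj₁ x∈T) , x∈X)

proposition12 : ∀ {n m k l : ℕ} (G : Graph n m) (X : Fin n → Subset k) (H : Graph k l) (f : Fin k → ℕ) →
    let C = ⟨ G , X , H , f ⟩ in
    IsConfiguration C →
    (v : Fin n) → v ∈ V G → ¬ IsSeparating G v →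
    (xᵥ : Fin k) → xᵥ ∈ X v → 0 < f xᵥ →
    let C′ = reduce C v xᵥ in
    IsConfiguration C′ ×
    (DegreeFeasible C → DegreeFeasible C′) ×
    (Uncolorable C → Uncolorable C′)
proposition12 G X H f cover v v∈ _ xᵥ xᵥ∈ fxᵥ>0 =
    cover-[] (V G - v) cover
  , reduce-degreeFeasible G X H f cover v v∈ xᵥ xᵥ∈
  , λ uncol → uncol ∘ reduce-colorable G X H f cover v v∈ xᵥ xᵥ∈ fxᵥ>0
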